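{- Let $X=MD(G,S_0,S_1,T_0,T_1)$ be max-$\lambda$ but not super-$\lambda$, and suppose $X$ is neither a directed cycle nor a cycle and does not belong to $\mathcal{F}$. Then $X$ belongs to $\mathcal{G}$ if and only if $X$ satisfies one of the following conditions: (1) $|T_0|=1$ or $|T_1|=1$, $1\leq|S_0|\leq|S_1|$, and $S_0\cup\{1_G\}$ is a subgroup of $G$; (2) $|T_0|=1$ or $|T_1|=1$, $1\leq|S_1|\leq|S_0|$, and $S_1\cup\{1_G\}$ is a subgroup of $G$.
   Context: $G$ is a finite group with identity $1_G$, $S_0,S_1\subseteq G\setminus\{1_G\}$, $T_0,T_1\subseteq G$. The mixed Cayley digraph $X=MD(G,S_0,S_1,T_0,T_1)$ has vertex set $G\times\{0,1\}$ and is the union of $\mathrm{Cay}(G\times\{0\},S_0)$ (arcs $((g,0),(sg,0))$, $s\in S_0$), $\mathrm{Cay}(G\times\{1\},S_1)$ (arcs $((g,1),(sg,1))$, $s\in S_1$) and $BD(G,T_0,T_1)$ (arcs $((g,0),(tg,1))$, $t\in T_0$, and $((tg,1),(g,0))$, $t\in T_1$), $g\in G$. $X_i=G\times\{i\}$. $\mathcal{F}$ is the class of such $X$ in which one of $\mathrm{Cay}(G\times\{0\},S_0)$, $\mathrm{Cay}(G\times\{1\},S_1)$ is a union of disjoint directed cycles, the other is a union of disjoint directed cycles of length two, and $BD(G,T_0,T_1)$ is a union of disjoint directed cycles of length two. "Cycle" means a symmetric digraph whose underlying graph is a cycle. $\delta(X)$ is the minimum over all vertices of all in- and out-degrees; $\lambda(X)$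 is the arc-connectivity. For $A\subseteq V(X)$, $\omega^+(A)$ (resp. $\omega^-(A)$) is the set of arcs leaving (resp. entering) $A$. A proper nonempty $A$ is an arc fragment if $|\omega^+(A)|=\lambda(X)$ or $|\omega^-(A)|=\lambda(X)$. A $\lambda$-superatom is an arc fragment with at least two vertices of least possible cardinality among such. $X$ is max-$\lambda$ if $\lambda(X)=\delta(X)$, and super-$\lambda$ if every minimum cut (a set $\omega^+(A)$, $A$ proper nonempty, of cardinality $\lambda(X)$) is the set of all inarcs or all outarcs of some vertex. $\mathcal{G}$ is the class of strongly connected mixed Cayley digraphs having a $\lambda$-superatom contained in $X_0$ or in $X_1$. -}

module Defs where

open import Data.Nat using (ℕ; zero; suc; _+_; _≤_; _%_)
open import Data.Bool using (Bool; true; false; _∧_; _∨_; not; if_then_else_)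
open import Data.Fin using (Fin; toℕ)
open import Data.Fin.Subset using (Subset; _∈_; _∉_; _∪_; ⁅_⁆; ∣_∣)
open import Data.Fin.Subset.Properties using (_∈?_)
open import Data.List using (List; []; _∷_; map; concatMap; allFin)
open import Data.Nat.ListAction using (sum)
open import Data.Product using (Σ; ∃; _×_; _,_; proj₁; proj₂)
open import Data.Sum using (_⊎_)
open import Data.Unit using (⊤)
open import Relation.Binary.PropositionalEquality using (_≡_)
open import Relation.Nullary using (¬_)
open import Relation.Nullary.Decidable using (⌊_⌋)
open import Algebra.Structures using (IsGroup)
open import Function.Definitions using (Injective; Surjective)

-- Finite groups: a group structure on the carrier Fin n
-- (every finite group is isomorphic to one of these).

record FinGroup (n : ℕ) : Set where
  infixl 7 _·_
  field
    _·_     : Fin n → Fin n → Fin n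
    e       : Fin n
    _⁻¹     : Fin n → Fin n
    isGroup : IsGroup _≡_ _·_ e _⁻¹

open FinGroup public

IsSubgroup : ∀ {n} → FinGroup n → Subset n → Set
IsSubgroup {n} G H =
  (e G ∈ H) ×
  (∀ (x y : Fin n) → x ∈ H → y ∈ H → _·_ G x y ∈ H) ×
  (∀ (x : Fin n) → x ∈ H → _⁻¹ G x ∈ H)

-- Digraphs on the vertex set Fin n × {0,1}  (false = 0, true = 1).
-- A (simple) digraph is given by its decidable arc relation.

V : ℕ → Set
V n = Fin n × Bool

Digraph : ℕ → Set
Digraph n = V n → V n → Bool

allV : (n : ℕ) → List (V n)
allV n = concatMap (λ b → map (λ g → (g , b)) (allFin n)) (false ∷ true ∷ [])

count : ∀ {n} → (V n → Bool) → ℕ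
count {n} p = sum (map (λ v → if p v then 1 else 0) (allV n))

count₂ : ∀ {n} → (V n → V n → Bool) → ℕ
count₂ {n} p = sum (map (λ u → count (p u)) (allV n))

outdeg indeg : ∀ {n} → Digraph n → V n → ℕ
outdeg D v = count (λ w → D v w)
indeg  D v = count (λ u → D u v)

VSet : ℕ → Set
VSet n = V n → Bool

∣_∣ᵥ : ∀ {n} → VSet n → ℕ
∣ A ∣ᵥ = count A

ProperNonempty : ∀ {n} → VSet n → Set
ProperNonempty {n} A = (Σ (V n) λ v → A v ≡ true) × (Σ (V n) λ v → A v ≡ false)

inω⁺ inω⁻ : ∀ {n} → Digraph n → VSet n → V n → V n → Bool
inω⁺ D A u w = A u ∧ not (A w) ∧ D u w
inω⁻ D A u w = not (A u) ∧ A w ∧ D u w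

∣ω⁺∣ ∣ω⁻∣ : ∀ {n} → Digraph n → VSet n → ℕ
∣ω⁺∣ D A = count₂ (inω⁺ D A)
∣ω⁻∣ D A = count₂ (inω⁻ D A)

IsArcConn : ∀ {n} → Digraph n → ℕ → Set
IsArcConn {n} D k =
  (Σ (VSet n) λ A → ProperNonempty A × ∣ω⁺∣ D A ≡ k) ×
  (∀ (A : VSet n) → ProperNonempty A → k ≤ ∣ω⁺∣ D A)

IsMinDeg : ∀ {n} → Digraph n → ℕ → Set
IsMinDeg {n} D k =
  (Σ (V n) λ v → (indeg D v ≡ k) ⊎ (outdeg D v ≡ k)) ×
  (∀ (v : V n) → (k ≤ indeg D v) × (k ≤ outdeg D v))

MaxLambda : ∀ {n} → Digraph n → Set
MaxLambda D = Σ ℕ λ k → IsArcConn D k × IsMinDeg D k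

SuperLambda : ∀ {n} → Digraph n → Set
SuperLambda {n} D =
  ∀ (k : ℕ) → IsArcConn D k → ∀ (A : VSet n) → ProperNonempty A → ∣ω⁺∣ D A ≡ k →
  Σ (V n) λ v →
    (∀ u w → (inω⁺ D A u w ≡ true) → (D u w ≡ true × w ≡ v)) ×
    (∀ u w → (D u w ≡ true × w ≡ v) → (inω⁺ D A u w ≡ true))
    ⊎
    (∀ u w → (inω⁺ D A u w ≡ true) → (D u w ≡ true × u ≡ v)) ×
    (∀ u w → (D u w ≡ true × u ≡ v) → (inω⁺ D A u w ≡ true))

data Reach {n} (D : Digraph n) : V n → V n → Set where
  here : ∀ {v} → Reach D v v
  step : ∀ {u v w} → D u v ≡ true → Reach D v w → Reach D u w

StronglyConnected : ∀ {n} → Digraph n → Set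
StronglyConnected {n} D = ∀ (u v : V n) → Reach D u v

ArcFragment : ∀ {n} → Digraph n → ℕ → VSet n → Set
ArcFragment D k A = ProperNonempty A × ((∣ω⁺∣ D A ≡ k) ⊎ (∣ω⁻∣ D A ≡ k))

Superatom : ∀ {n} → Digraph n → ℕ → VSet n → Set
Superatom {n} D k A =
  ArcFragment D k A × 2 ≤ ∣ A ∣ᵥ ×
  (∀ (B : VSet n) → ArcFragment D k B → 2 ≤ ∣ B ∣ᵥ → ∣ A ∣ᵥ ≤ ∣ B ∣ᵥ)

InLayer : ∀ {n} → Bool → VSet n → Set
InLayer i A = ∀ v → A v ≡ true → proj₂ v ≡ i

IsDirectedCycle : ∀ {n} → Digraph n → Set
IsDirectedCycle {n} D =
  Σ ℕ λ m → Σ (Fin (suc m) → V n) λ f →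
    Injective _≡_ _≡_ f × Surjective _≡_ _≡_ f ×
    (∀ i j → D (f i) (f j) ≡ true →  toℕ j ≡ (suc (toℕ i)) % (suc m)) ×
    (∀ i j → toℕ j ≡ (suc (toℕ i)) % (suc m) → D (f i) (f j) ≡ true)

IsCycle : ∀ {n} → Digraph n → Set
IsCycle {n} D =
  Σ ℕ λ m → 3 ≤ suc m × Σ (Fin (suc m) → V n) λ f →
    Injective _≡_ _≡_ f × Surjective _≡_ _≡_ f ×
    (∀ i j → D (f i) (f j) ≡ true →
       (toℕ j ≡ (suc (toℕ i)) % (suc m)) ⊎ (toℕ i ≡ (suc (toℕ j)) % (suc m))) ×
    (∀ i j → (toℕ j ≡ (suc (toℕ i)) % (suc m)) ⊎ (toℕ i ≡ (suc (toℕ j)) % (suc m)) →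
       D (f i) (f j) ≡ true)

module _ {n : ℕ} (G : FinGroup n) where

  private
    _·ᴳ_ = _·_ G
    inv = _⁻¹ G

  inCoset : Fin n → Subset n → Fin n → Bool
  inCoset h S g = ⌊ (h ·ᴳ inv g) ∈? S ⌋

  CayArc : Bool → Subset n → Digraph n
  CayArc false S (g , false) (h , false) = inCoset h S g
  CayArc true  S (g , true)  (h , true)  = inCoset h S g
  CayArc _     _ _           _           = false

  BDArc : Subset n → Subset n → Digraph n
  BDArc T₀ T₁ (g , false) (h , true)  = inCoset h T₀ g
  BDArc T₀ T₁ (h , true)  (g , false) = inCoset h T₁ g
  BDArc T₀ T₁ _           _           = false

  MD : (S₀ S₁ T₀ T₁ : Subset n) → Digraph n
  MD S₀ S₁ T₀ T₁ u w = CayArc false S₀ u w ∨ CayArc true S₁ u w ∨ BDArc T₀ T₁ u w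

  -- the spanning subdigraph D on layer W (a set of vertices) is a union of
  -- vertex-disjoint directed cycles covering W: every vertex of W has exactly
  -- one out-neighbour and exactly one in-neighbour in D
  UnionDirCycles : (V n → Set) → Digraph n → Set
  UnionDirCycles W D = ∀ v → W v → (outdeg D v ≡ 1) × (indeg D v ≡ 1)

  UnionDigons : (V n → Set) → Digraph n → Set
  UnionDigons W D = UnionDirCycles W D × (∀ u w → D u w ≡ true → D w u ≡ true)

  Layer : Bool → V n → Set
  Layer i v = proj₂ v ≡ i

  AllV : V n → Set
  AllV _ = ⊤

  InF : (S₀ S₁ T₀ T₁ : Subset n) → Set
  InF S₀ S₁ T₀ T₁ =
    ((UnionDirCycles (Layer false) (CayArc false S₀) ×
      UnionDigons (Layer true) (CayArc true S₁))
     ⊎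
     (UnionDirCycles (Layer true) (CayArc true S₁) ×
      UnionDigons (Layer false) (CayArc false S₀)))
    × UnionDigons AllV (BDArc T₀ T₁)

InG : ∀ {n} → Digraph n → Set
InG {n} D =
  StronglyConnected D ×
  Σ ℕ λ k → IsArcConn D k ×
    Σ (VSet n) λ A → Superatom D k A × (InLayer false A ⊎ InLayer true A)

{-# OPTIONS --safe #-}
module Submission where

-- Let k = λ(X) = δ(X).  A vertex of A has at most |A| - 1 out-neighbours in A, so an arc fragment with
-- at least two vertices has at least k of them.  A fragment A inside layer i sends |T_i| arcs per vertex
-- to the other layer, so k = |ω⁺(A)| ≥ |A| |T_i| ≥ k forces |T_i| = 1, |A| = k, no arc leaving A inside
-- the layer, and then, by degrees, A complete of size |S_i| + 1: thus (S_i ∪ {1}) b = A for each b in A,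
-- which makes S_i ∪ {1} a subgroup.  Conversely (S_i ∪ {1}) × {i} is a fragment of size k, the least
-- possible.  In-cuts are the out-cuts of the reversed digraph.

open import Defs hiding (_⁻¹; _·_)
open import Algebra.Bundles using (Group)
import Algebra.Properties.Group as GroupProperties
open import Data.Bool using (Bool; true; false; _∧_; _∨_; not; if_then_else_)
import Data.Bool.Properties as Bool
open import Data.Fin using (Fin; zero; suc)
open import Data.Fin.Permutation using (permutation)
import Data.Fin.Properties as Fin
open import Data.Fin.Subset using (Subset; _∈_; _∉_; _∪_; ⁅_⁆; ∣_∣; inside; outside)
open import Data.Fin.Subset.Properties using (_∈?_; ∪-identityʳ; x∈p∪q⁺; x∈p∪q⁻; x∈⁅x⁆; x∈⁅y⁆⇒x≡y)
open import Data.List using (List; []; _∷_; _++_; map; allFin; tabulate)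
open import Data.List.Membership.Propositional using () renaming (_∈_ to _∈ˡ_)
open import Data.List.Membership.Propositional.Properties using (∈-allFin; ∈-map⁺; ∈-++⁺ˡ; ∈-++⁺ʳ)
open import Data.List.Properties using (map-++; map-∘; map-tabulate; map-cong; ++-identityʳ)
open import Data.List.Relation.Unary.Any using (here; there)
open import Data.Nat using (ℕ; zero; suc; _+_; _*_; _≤_; _<_; z≤n; s≤s; >-nonZero)
open import Data.Nat.ListAction using (sum)
open import Data.Nat.ListAction.Properties using (sum-++)
open import Data.Nat.Properties
open import Data.Product using (Σ; ∃; ∃-syntax; _×_; _,_; proj₁; proj₂)
open import Data.Product.Properties using (≡-dec)
open import Data.Sum using (_⊎_; inj₁; inj₂; [_,_]′; swap) renaming (map to map₊)
open import Data.Vec using ([]; _∷_; here; there)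
open import Function using (_∘_; flip; id)
open import Function.Bundles using (_⇔_; mk⇔)
open import Relation.Binary.PropositionalEquality
open import Relation.Nullary using (¬_; contradiction; yes; no)
open import Relation.Nullary.Decidable using (⌊_⌋)
open import Algebra.Properties.CommutativeMonoid.Sum +-0-commutativeMonoid
  using (sum-permute; sum-cong-≗) renaming (sum to sumᶠ)
open import Algebra.Properties.CommutativeSemigroup +-commutativeSemigroup using (interchange)

-- Finite sums over lists.

private variable
  X Y : Set

Σᴸ : List X → (X → ℕ) → ℕ
Σᴸ xs f = sum (map f xs)

𝟙 : Bool → ℕ
𝟙 b = if b then 1 else 0

𝟙-mono : ∀ {a b} → (a ≡ true → b ≡ true) → 𝟙 a ≤ 𝟙 b
𝟙-mono {false}     h = z≤n
𝟙-mono {true}  {b} h rewrite h refl = ≤-refl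

𝟙-mono-< : ∀ {a b} → a ≡ false → b ≡ true → 𝟙 a < 𝟙 b
𝟙-mono-< refl refl = ≤-refl

module _ {f g : X → ℕ} where

  Σᴸ-cong : (∀ x → f x ≡ g x) → ∀ xs → Σᴸ xs f ≡ Σᴸ xs g
  Σᴸ-cong f≡g xs = cong sum (map-cong f≡g xs)

  Σᴸ-mono : (∀ x → f x ≤ g x) → ∀ xs → Σᴸ xs f ≤ Σᴸ xs g
  Σᴸ-mono f≤g []       = z≤n
  Σᴸ-mono f≤g (x ∷ xs) = +-mono-≤ (f≤g x) (Σᴸ-mono f≤g xs)

  Σᴸ-mono-< : (∀ x → f x ≤ g x) → ∀ {x xs} → x ∈ˡ xs → f x < g x → Σᴸ xs f < Σᴸ xs g
  Σᴸ-mono-< f≤g {xs = _ ∷ xs} (here refl) fx<gx = +-mono-<-≤ fx<gx (Σᴸ-mono f≤g xs)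
  Σᴸ-mono-< f≤g {xs = y ∷ _}  (there x∈)  fx<gx = +-mono-≤-< (f≤g y) (Σᴸ-mono-< f≤g x∈ fx<gx)

  -- Distinct elements occupy distinct positions in the list, so the two strict gains add up. This
  -- is what later rules out a missing arc inside a fragment.
  Σᴸ-mono-<² : (∀ x → f x ≤ g x) → ∀ {x y xs} → x ≢ y → x ∈ˡ xs → y ∈ˡ xs →
               f x < g x → f y < g y → 2 + Σᴸ xs f ≤ Σᴸ xs g
  Σᴸ-mono-<² f≤g x≢y (here refl) (here refl) _ _ = contradiction refl x≢y
  Σᴸ-mono-<² f≤g {xs = z ∷ xs} x≢y (here refl) (there y∈) fx<gx fy<gy =
    subst (_≤ g z + Σᴸ xs g) (+-suc (suc (f z)) _) (+-mono-≤ fx<gx (Σᴸ-mono-< f≤g y∈ fy<gy))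
  Σᴸ-mono-<² f≤g {xs = z ∷ xs} x≢y (there x∈) (here refl) fx<gx fy<gy =
    subst (_≤ g z + Σᴸ xs g) (+-suc (suc (f z)) _) (+-mono-≤ fy<gy (Σᴸ-mono-< f≤g x∈ fx<gx))
  Σᴸ-mono-<² f≤g {xs = z ∷ xs} x≢y (there x∈) (there y∈) fx<gx fy<gy =
    subst (_≤ g z + Σᴸ xs g) (trans (+-suc (f z) _) (cong suc (+-suc (f z) _)))
      (+-mono-≤ (f≤g z) (Σᴸ-mono-<² f≤g x≢y x∈ y∈ fx<gx fy<gy))

Σᴸ-zero : (xs : List X) → Σᴸ xs (λ _ → 0) ≡ 0
Σᴸ-zero []       = refl
Σᴸ-zero (_ ∷ xs) = Σᴸ-zero xs

Σᴸ-+ : ∀ (f g : X → ℕ) xs → Σᴸ xs (λ x → f x + g x) ≡ Σᴸ xs f + Σᴸ xs g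
Σᴸ-+ f g []       = refl
Σᴸ-+ f g (x ∷ xs) = trans (cong (f x + g x +_) (Σᴸ-+ f g xs)) (interchange (f x) (g x) _ _)

Σᴸ-* : ∀ (f : X → ℕ) c xs → Σᴸ xs (λ x → f x * c) ≡ Σᴸ xs f * c
Σᴸ-* f c []       = refl
Σᴸ-* f c (x ∷ xs) = trans (cong (f x * c +_) (Σᴸ-* f c xs)) (sym (*-distribʳ-+ c (f x) _))

Σᴸ-swap : ∀ (f : X → Y → ℕ) xs ys →
          Σᴸ xs (λ x → Σᴸ ys (f x)) ≡ Σᴸ ys (λ y → Σᴸ xs (λ x → f x y))
Σᴸ-swap f []       ys = sym (Σᴸ-zero ys)
Σᴸ-swap f (x ∷ xs) ys = trans (cong (Σᴸ ys (f x) +_) (Σᴸ-swap f xs ys))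
                              (sym (Σᴸ-+ (f x) _ ys))

Σᴸ-positive : ∀ (f : X → ℕ) xs → 1 ≤ Σᴸ xs f → ∃ λ x → 1 ≤ f x
Σᴸ-positive f (x ∷ xs) pos with f x in eq
... | zero  = Σᴸ-positive f xs pos
... | suc _ = x , ≤-trans (s≤s z≤n) (≤-reflexive (sym eq))

-- Counting elements of `Fin n` and of its subsets.

countᶠ : ∀ {n} → (Fin n → Bool) → ℕ
countᶠ {n} p = Σᴸ (allFin n) (𝟙 ∘ p)

-- The `Fin`-indexed sum is the form suited to permuting the index and to recursion along a
-- `Subset`.
countᶠ-sumᶠ : ∀ {n} (p : Fin n → Bool) → countᶠ p ≡ sumᶠ (𝟙 ∘ p)
countᶠ-sumᶠ {n} p = trans (cong sum (map-tabulate (λ x → x) (𝟙 ∘ p))) (sum-tabulate (𝟙 ∘ p))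
  where
  sum-tabulate : ∀ {m} (f : Fin m → ℕ) → sum (tabulate f) ≡ sumᶠ f
  sum-tabulate {zero}  f = refl
  sum-tabulate {suc m} f = cong (f zero +_) (sum-tabulate (f ∘ suc))

member : ∀ {n} → Subset n → Fin n → Bool
member S x = ⌊ x ∈? S ⌋

countᶠ-member : ∀ {n} (S : Subset n) → countᶠ (member S) ≡ ∣ S ∣
countᶠ-member S = trans (countᶠ-sumᶠ (member S)) (go S)
  where
  member-suc : ∀ {n} b (S : Subset n) x → 𝟙 (member (b ∷ S) (suc x)) ≡ 𝟙 (member S x)
  member-suc b S x with x ∈? S
  ... | yes _ = refl
  ... | no  _ = refl
  go : ∀ {n} (S : Subset n) → sumᶠ (𝟙 ∘ member S) ≡ ∣ S ∣
  go []            = refl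
  go (inside  ∷ S) = cong suc (trans (sum-cong-≗ (member-suc inside S)) (go S))
  go (outside ∷ S) = trans (sum-cong-≗ (member-suc outside S)) (go S)

countᶠ-permute : ∀ {n} (p : Fin n → Bool) (π ρ : Fin n → Fin n) →
                 (∀ x → π (ρ x) ≡ x) → (∀ x → ρ (π x) ≡ x) → countᶠ (p ∘ π) ≡ countᶠ p
countᶠ-permute p π ρ πρ ρπ = begin
  countᶠ (p ∘ π)     ≡⟨ countᶠ-sumᶠ (p ∘ π) ⟩
  sumᶠ (𝟙 ∘ p ∘ π)   ≡⟨ sum-permute (𝟙 ∘ p) (permutation π ρ πρ ρπ) ⟨
  sumᶠ (𝟙 ∘ p)       ≡⟨ countᶠ-sumᶠ p ⟨
  countᶠ p           ∎
  where open ≡-Reasoning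

∣p∪⁅x⁆∣≡1+∣p∣ : ∀ {n} {p : Subset n} {x} → x ∉ p → ∣ p ∪ ⁅ x ⁆ ∣ ≡ suc ∣ p ∣
∣p∪⁅x⁆∣≡1+∣p∣ {p = inside  ∷ p} {zero}  x∉p = contradiction here x∉p
∣p∪⁅x⁆∣≡1+∣p∣ {p = outside ∷ p} {zero}  x∉p = cong (suc ∘ ∣_∣) (∪-identityʳ p)
∣p∪⁅x⁆∣≡1+∣p∣ {p = inside  ∷ p} {suc x} x∉p = cong suc (∣p∪⁅x⁆∣≡1+∣p∣ (x∉p ∘ there))
∣p∪⁅x⁆∣≡1+∣p∣ {p = outside ∷ p} {suc x} x∉p = ∣p∪⁅x⁆∣≡1+∣p∣ (x∉p ∘ there)

-- Counting vertices layer by layer.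

∈-allV : ∀ {n} (v : V n) → v ∈ˡ allV n
∈-allV {n} (g , false) = ∈-++⁺ˡ (∈-map⁺ (_, false) (∈-allFin g))
∈-allV {n} (g , true)  = ∈-++⁺ʳ (map (_, false) (allFin n))
                           (∈-++⁺ˡ (∈-map⁺ (_, true) (∈-allFin g)))

-- The chosen layer `i` comes first, so that later arguments treat both layers at once.
count-layers : ∀ {n} i (p : V n → Bool) →
               count p ≡ countᶠ (λ g → p (g , i)) + countᶠ (λ g → p (g , not i))
count-layers {n} false p = begin
  Σᴸ (allV n) (𝟙 ∘ p)                          ≡⟨ cong (λ vs → Σᴸ (L₀ ++ vs) (𝟙 ∘ p)) (++-identityʳ L₁) ⟩
  Σᴸ (L₀ ++ L₁) (𝟙 ∘ p)                        ≡⟨ cong sum (map-++ (𝟙 ∘ p) L₀ L₁) ⟩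
  sum (map (𝟙 ∘ p) L₀ ++ map (𝟙 ∘ p) L₁)       ≡⟨ sum-++ (map (𝟙 ∘ p) L₀) _ ⟩
  Σᴸ L₀ (𝟙 ∘ p) + Σᴸ L₁ (𝟙 ∘ p)                ≡⟨ cong₂ (λ a b → sum a + sum b) (map-∘ (allFin n)) (map-∘ (allFin n)) ⟨
  countᶠ (λ g → p (g , false)) + countᶠ (λ g → p (g , true)) ∎
  where
  open ≡-Reasoning
  L₀ = map (_, false) (allFin n)
  L₁ = map (_, true)  (allFin n)
count-layers true p = trans (count-layers false p) (+-comm (countᶠ (λ g → p (g , false))) _)

-- Arc cuts and reversal.

true≢false : ∀ {b} → b ≡ true → b ≢ false
true≢false refl ()

∧-true⁻ : ∀ {a b} → a ∧ b ≡ true → a ≡ true × b ≡ true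
∧-true⁻ {true} {true} refl = refl , refl

inω⁺-intro : ∀ {n} (D : Digraph n) A {u w} →
             A u ≡ true → A w ≡ false → D u w ≡ true → inω⁺ D A u w ≡ true
inω⁺-intro D A p q r rewrite p | q | r = refl

inω⁺-elim : ∀ {n} (D : Digraph n) A u w → inω⁺ D A u w ≡ true →
            A u ≡ true × A w ≡ false × D u w ≡ true
inω⁺-elim D A u w h with A u | A w
inω⁺-elim D A u w h | true | false = refl , refl , h

1≤𝟙⇒true : ∀ {b} → 1 ≤ 𝟙 b → b ≡ true
1≤𝟙⇒true {true} _ = refl

countᶠ-mono : ∀ {n} {p q : Fin n → Bool} → (∀ x → p x ≡ true → q x ≡ true) → countᶠ p ≤ countᶠ q
countᶠ-mono {n} h = Σᴸ-mono (λ x → 𝟙-mono (h x)) (allFin n)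

countᶠ-positive : ∀ {n} (p : Fin n → Bool) x → p x ≡ true → 1 ≤ countᶠ p
countᶠ-positive {n} p x px = subst (_< countᶠ p) (Σᴸ-zero (allFin n))
  (Σᴸ-mono-< (λ _ → z≤n) (∈-allFin x) (𝟙-mono-< {false} refl px))

-- Exchanging the order of summation swaps tails and heads; statements about out-cuts thus transfer
-- to in-cuts.
∣ω⁺∣-flip : ∀ {n} (D : Digraph n) A → ∣ω⁺∣ (flip D) A ≡ ∣ω⁻∣ D A
∣ω⁺∣-flip {n} D A = trans (Σᴸ-swap (λ w u → 𝟙 (inω⁺ (flip D) A w u)) (allV n) (allV n))
  (Σᴸ-cong (λ u → Σᴸ-cong (λ w → cong 𝟙 (∧-left-comm (A w) (not (A u)) (D u w))) (allV n)) (allV n))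
  where
  ∧-left-comm : ∀ a b c → a ∧ b ∧ c ≡ b ∧ a ∧ c
  ∧-left-comm a b c = trans (sym (Bool.∧-assoc a b c))
                     (trans (cong (_∧ c) (Bool.∧-comm a b)) (Bool.∧-assoc b a c))

∣ω⁺∣-positive : ∀ {n} (D : Digraph n) A → 1 ≤ ∣ω⁺∣ D A →
                ∃[ u ] ∃[ w ] A u ≡ true × A w ≡ false × D u w ≡ true
∣ω⁺∣-positive {n} D A pos with Σᴸ-positive (λ u → count (inω⁺ D A u)) (allV n) pos
... | u , pos′ with Σᴸ-positive (λ w → 𝟙 (inω⁺ D A u w)) (allV n) pos′
...   | w , pos″ = u , w , inω⁺-elim D A u w (1≤𝟙⇒true pos″)

IsArcConn-unique : ∀ {n} {D : Digraph n} {k l} → IsArcConn D k → IsArcConn D l → k ≡ l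
IsArcConn-unique ((A , pA , ωA) , minₖ) ((B , pB , ωB) , minₗ) =
  ≤-antisym (≤-trans (minₖ B pB) (≤-reflexive ωB)) (≤-trans (minₗ A pA) (≤-reflexive ωA))

-- Reachability and strong connectivity.

Reach-trans : ∀ {n} {D : Digraph n} {u v w} → Reach D u v → Reach D v w → Reach D u w
Reach-trans here        q = q
Reach-trans (step uv p) q = step uv (Reach-trans p q)

Reach-leaves : ∀ {n} {D : Digraph n} (A : VSet n) {u v} → A u ≡ true → A v ≡ false → Reach D u v →
               ∃[ x ] ∃[ y ] A x ≡ true × A y ≡ false × D x y ≡ true
Reach-leaves A Au ¬Av here = contradiction ¬Av (true≢false Au)
Reach-leaves A {u} Au ¬Av (step {v = x} ux p) with A x in eq
... | true  = Reach-leaves A eq ¬Av p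
... | false = u , x , Au , eq , ux

insert : ∀ {n} → V n → VSet n → VSet n
insert w A z = A z ∨ ⌊ ≡-dec Fin._≟_ Bool._≟_ z w ⌋

-- Grow the set of vertices known to be reachable from u, one leaving arc at a time.
λ-positive⇒stronglyConnected : ∀ {n} {D : Digraph n} {k} → 1 ≤ k → IsArcConn D k → StronglyConnected D
λ-positive⇒stronglyConnected {n} {D} 1≤k (_ , k≤ω) u v =
  grow ∣V∣ (insert u (λ _ → false)) (insert-self u (λ _ → false))
    (λ w w∈ → subst (Reach D u) (sym (insert-false w w∈)) here) (m≤n+m ∣V∣ _)
  where
  ∣V∣ = count {n} (λ _ → true)
  insert-self : ∀ w A → insert w A w ≡ true
  insert-self w A with ≡-dec Fin._≟_ Bool._≟_ w w
  ... | yes _  = Bool.∨-zeroʳ (A w)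
  ... | no w≢w = contradiction refl w≢w
  insert-⊇ : ∀ w A z → A z ≡ true → insert w A z ≡ true
  insert-⊇ w A z p rewrite p = refl
  insert-false : ∀ w → insert u (λ _ → false) w ≡ true → w ≡ u
  insert-false w p with ≡-dec Fin._≟_ Bool._≟_ w u
  ... | yes w≡u = w≡u
  insert-reach : ∀ w A → (∀ z → A z ≡ true → Reach D u z) → Reach D u w →
                 ∀ z → insert w A z ≡ true → Reach D u z
  insert-reach w A r uw z p with A z in eq | ≡-dec Fin._≟_ Bool._≟_ z w
  ... | true  | _        = r z eq
  ... | false | yes refl = uw
  -- `m` bounds the number of vertices still outside `A`; when it reaches zero, `v` can no longer be
  -- outside.
  grow : ∀ m A → A u ≡ true → (∀ z → A z ≡ true → Reach D u z) →
         ∣V∣ ≤ count A + m → Reach D u v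
  grow m A Au r bound with A v in Av
  ... | true = r v Av
  grow zero A Au r bound | false =
    contradiction (subst (∣V∣ ≤_) (+-identityʳ _) bound)
      (<⇒≱ (Σᴸ-mono-< (λ _ → 𝟙-mono (λ _ → refl)) (∈-allV v) (𝟙-mono-< Av refl)))
  grow (suc m) A Au r bound | false
    with x , y , Ax , Ay , xy ← ∣ω⁺∣-positive D A (≤-trans 1≤k (k≤ω A ((u , Au) , (v , Av)))) =
    grow m (insert y A) (insert-⊇ y A u Au)
      (insert-reach y A r (Reach-trans (r x Ax) (step xy here)))
      (≤-trans (subst (∣V∣ ≤_) (+-suc (count A) m) bound)
        (+-monoˡ-≤ m (Σᴸ-mono-< (λ z → 𝟙-mono (insert-⊇ y A z)) (∈-allV y)
          (𝟙-mono-< Ay (insert-self y A)))))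

-- The size of arc fragments.

record Loopless {n} (D : Digraph n) : Set where
  constructor loopless
  field no-loop : ∀ u → D u u ≡ false
open Loopless

module _ {n} (D : Digraph n) (A : VSet n) where

  -- `external` vanishes off `A`, and its sum over all vertices is `∣ω⁺∣ D A` by definition.
  internal external : V n → ℕ
  internal u = count (λ w → A w ∧ D u w)
  external u = count (inω⁺ D A u)

  outdeg-split : ∀ u → A u ≡ true → outdeg D u ≡ internal u + external u
  outdeg-split u Au = trans (Σᴸ-cong split (allV n)) (Σᴸ-+ _ _ (allV n))
    where
    split : ∀ w → 𝟙 (D u w) ≡ 𝟙 (A w ∧ D u w) + 𝟙 (inω⁺ D A u w)
    split w rewrite Au with A w
    ... | true  = sym (+-identityʳ _)
    ... | false = refl

  internal-≤ : ∀ u w → 𝟙 (A w ∧ D u w) ≤ 𝟙 (A w)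
  internal-≤ u w = 𝟙-mono (proj₁ ∘ ∧-true⁻)

  internal-gap : ∀ {u w} → D u w ≡ false → A w ≡ true → 𝟙 (A w ∧ D u w) < 𝟙 (A w)
  internal-gap {u} {w} uw Aw = 𝟙-mono-< (trans (cong (A w ∧_) uw) (Bool.∧-zeroʳ (A w))) Aw

  -- `u` itself belongs to `A` but is not its own out-neighbour.
  internal-< : Loopless D → ∀ u → A u ≡ true → internal u < count A
  internal-< l u Au = Σᴸ-mono-< (internal-≤ u) (∈-allV u) (internal-gap (no-loop l u) Au)

  -- Both `u` and the non-neighbour `w` are missed.
  internal-<² : Loopless D → ∀ {u w} → A u ≡ true → A w ≡ true → u ≢ w → D u w ≡ false →
                2 + internal u ≤ count A
  internal-<² l {u} {w} Au Aw u≢w uw =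
    Σᴸ-mono-<² (internal-≤ u) u≢w (∈-allV u) (∈-allV w)
      (internal-gap (no-loop l u) Au) (internal-gap uw Aw)

-- The second hypothesis amounts to (a - 1)(k - a) ≤ 0, and a - 1 is positive.
size-arith : ∀ {a k} → 2 ≤ a → a * suc k ≤ a * a + k → k ≤ a
size-arith {a} {k} 2≤a h = ≮⇒≥ λ a<k → go (m≤n⇒∃[o]m+o≡n a<k)
  where
  open ≤-Reasoning
  go : ∃ (λ m → suc a + m ≡ k) → _
  -- Here `k` is `a + 1 + m`. After removing `a * a` it remains to see that `a + 1 + m` is less than
  -- `a * (m + 2)`; `2 ≤ a` enters as `2 * (m + 1) ≤ a * (m + 1)`.
  go (m , refl) = <-irrefl refl (begin-strict
    a * a + (suc a + m)       <⟨ +-monoʳ-< (a * a) (s≤s (≤-reflexive (sym (+-suc a m)))) ⟩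
    a * a + (suc a + suc m)   ≤⟨ +-monoʳ-≤ (a * a) (subst (_≤ a + (suc m + suc m)) (+-suc a (suc m)) (+-monoʳ-≤ a (s≤s (m≤n+m _ m)))) ⟩
    a * a + (a + (suc m + suc m)) ≤⟨ +-monoʳ-≤ (a * a) (+-monoʳ-≤ a (subst (_≤ a * suc m) (cong (suc m +_) (+-identityʳ (suc m))) (*-monoˡ-≤ (suc m) 2≤a))) ⟩
    a * a + (a + a * suc m)   ≡⟨ cong (a * a +_) (*-suc a (suc m)) ⟨
    a * a + a * suc (suc m)   ≡⟨ *-distribˡ-+ a a (suc (suc m)) ⟨
    a * (a + suc (suc m))     ≡⟨ cong (a *_) (trans (+-suc a (suc m)) (cong suc (+-suc a m))) ⟩
    a * suc (suc a + m)       ≤⟨ h ⟩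
    a * a + (suc a + m)       ∎)

-- Makes a bound known only on the vertices of `A` summable over all vertices.
𝟙-weighted : ∀ b {x y z} → (b ≡ true → x ≤ y + z) → 𝟙 b * x ≤ 𝟙 b * y + z
𝟙-weighted false     h = z≤n
𝟙-weighted true  {x} {y} {z} h = subst₂ (λ a c → a ≤ c + z) (sym (*-identityˡ x)) (sym (*-identityˡ y)) (h refl)

-- |ω⁺(A)| ≥ |A| (k - |A| + 1), which exceeds k for 2 ≤ |A| < k.
fragment-size : ∀ {n} {D : Digraph n} {k} → Loopless D → (∀ v → k ≤ outdeg D v) →
                ∀ A → 2 ≤ count A → ∣ω⁺∣ D A ≡ k → k ≤ count A
fragment-size {n} {D} {k} l k≤out A 2≤a refl = size-arith 2≤a (begin
  count A * suc k                                       ≡⟨ Σᴸ-* (𝟙 ∘ A) (suc k) (allV n) ⟨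
  Σᴸ (allV n) (λ u → 𝟙 (A u) * suc k)                   ≤⟨ Σᴸ-mono row (allV n) ⟩
  Σᴸ (allV n) (λ u → 𝟙 (A u) * count A + external D A u) ≡⟨ Σᴸ-+ _ _ (allV n) ⟩
  Σᴸ (allV n) (λ u → 𝟙 (A u) * count A) + k             ≡⟨ cong (_+ k) (Σᴸ-* (𝟙 ∘ A) (count A) (allV n)) ⟩
  count A * count A + k                                 ∎)
  where
  open ≤-Reasoning
  row : ∀ u → 𝟙 (A u) * suc k ≤ 𝟙 (A u) * count A + external D A u
  row u = 𝟙-weighted (A u) λ Au → begin
    suc k                                        ≤⟨ s≤s (k≤out u) ⟩
    suc (outdeg D u)                             ≡⟨ cong suc (outdeg-split D A u Au) ⟩
    suc (internal D A u) + external D A u        ≤⟨ +-monoˡ-≤ _ (internal-< D A l u Au) ⟩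
    count A + external D A u                     ∎

-- Fragments contained in one layer.

record LayerRegular {n} (D : Digraph n) (i : Bool) (s t : ℕ) : Set where
  field
    within : ∀ g → countᶠ (λ h → D (g , i) (h , i)) ≡ s
    across : ∀ g → countᶠ (λ h → D (g , i) (h , not i)) ≡ t

  outdeg≡ : ∀ g → outdeg D (g , i) ≡ s + t
  outdeg≡ g = trans (count-layers i (D (g , i))) (cong₂ _+_ (within g) (across g))

LayerClosed : ∀ {n} → Digraph n → Bool → VSet n → Set
LayerClosed D i A = ∀ g h → A (g , i) ≡ true → D (g , i) (h , i) ≡ true → A (h , i) ≡ true

𝟙*-≤ : ∀ b {x y} → (b ≡ true → x ≤ y) → 𝟙 b * x ≤ y
𝟙*-≤ false    h = z≤n
𝟙*-≤ true {x} h = subst (_≤ _) (sym (*-identityˡ x)) (h refl)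

off-layer : ∀ {n i} {A : VSet n} → InLayer i A → ∀ h → A (h , not i) ≡ false
off-layer {i = i} {A} inL h with A (h , not i) in eq
... | false = refl
... | true  = contradiction (sym (inL _ eq)) (Bool.not-¬ refl)

-- What equality in the counting forces. Together, `closed` and `complete` say that each vertex of
-- `A` and its out-neighbours in the layer make up exactly `A`.
record LayerFragment {n} (D : Digraph n) (i : Bool) (s t k : ℕ) (A : VSet n) : Set where
  field
    t≡1      : t ≡ 1
    1≤s      : 1 ≤ s
    k≡1+s    : k ≡ suc s
    closed   : LayerClosed D i A
    complete : ∀ u w → A u ≡ true → A w ≡ true → u ≢ w → D u w ≡ true

module _ {n} {D : Digraph n} {i s t} (reg : LayerRegular D i s t)
         {A : VSet n} (inL : InLayer i A) where
  open LayerRegular reg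

  external-layers : ∀ g → external D A (g , i) ≡
    countᶠ (λ h → inω⁺ D A (g , i) (h , i)) + countᶠ (λ h → inω⁺ D A (g , i) (h , not i))
  external-layers g = count-layers i (inω⁺ D A (g , i))

  -- Since `A` stays in layer `i`, every arc to the other layer leaves it.
  t≤across : ∀ g → A (g , i) ≡ true → t ≤ countᶠ (λ h → inω⁺ D A (g , i) (h , not i))
  t≤across g Ag = subst (_≤ _) (across g)
    (countᶠ-mono (λ h → inω⁺-intro D A Ag (off-layer inL h)))

  t≤external : ∀ u → A u ≡ true → t ≤ external D A u
  t≤external (g , j) Ag with refl ← inL _ Ag =
    ≤-trans (t≤across g Ag) (≤-trans (m≤n+m _ _) (≤-reflexive (sym (external-layers g))))

  t<external : ∀ g h → A (g , i) ≡ true → A (h , i) ≡ false → D (g , i) (h , i) ≡ true →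
               t < external D A (g , i)
  t<external g h Ag Ah gh = ≤-trans
    (+-mono-≤ (countᶠ-positive _ h (inω⁺-intro D A Ag Ah gh)) (t≤across g Ag))
    (≤-reflexive (sym (external-layers g)))

  ∣A∣*t≡ : Σᴸ (allV n) (λ u → 𝟙 (A u) * t) ≡ count A * t
  ∣A∣*t≡ = Σᴸ-* (𝟙 ∘ A) t (allV n)

  row≤ : ∀ u → 𝟙 (A u) * t ≤ external D A u
  row≤ u = 𝟙*-≤ (A u) (t≤external u)

  ∣A∣*t≤∣ω⁺∣ : count A * t ≤ ∣ω⁺∣ D A
  ∣A∣*t≤∣ω⁺∣ = subst (_≤ ∣ω⁺∣ D A) ∣A∣*t≡ (Σᴸ-mono row≤ (allV n))

  -- The arcs between the layers already fill the cut; one more arc leaving `A` inside the layer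
  -- would make a row strict.
  ∣ω⁺∣≤∣A∣*t⇒closed : ∣ω⁺∣ D A ≤ count A * t → LayerClosed D i A
  ∣ω⁺∣≤∣A∣*t⇒closed ω≤ g h Ag gh with A (h , i) in Ah
  ... | true  = refl
  ... | false = contradiction ω≤ (<⇒≱ (subst (_< ∣ω⁺∣ D A) ∣A∣*t≡
          (Σᴸ-mono-< row≤ (∈-allV (g , i))
            (subst (_< external D A (g , i)) (sym (trans (cong (λ b → 𝟙 b * t) Ag) (*-identityˡ t)))
              (t<external g h Ag Ah gh)))))

  closed⇒s≤internal : LayerClosed D i A → ∀ u → A u ≡ true → s ≤ internal D A u
  closed⇒s≤internal cl (g , j) Ag with refl ← inL _ Ag = begin
    s                                                ≡⟨ within g ⟨
    countᶠ (λ h → D (g , i) (h , i))                 ≤⟨ countᶠ-mono (λ h gh → cong₂ _∧_ (cl g h Ag gh) gh) ⟩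
    countᶠ (λ h → A (h , i) ∧ D (g , i) (h , i))     ≤⟨ m≤m+n _ _ ⟩
    _                                                ≡⟨ count-layers i (λ w → A w ∧ D (g , i) w) ⟨
    internal D A (g , i)                             ∎
    where open ≤-Reasoning

  -- With fragment-size, t |A| ≤ |ω⁺(A)| = k ≤ |A|, so equality holds throughout.
  layerFragment : ∀ {k} → Loopless D → 1 ≤ t → (∀ v → k ≤ outdeg D v) →
                  ProperNonempty A → 2 ≤ count A → ∣ω⁺∣ D A ≡ k → LayerFragment D i s t k A
  layerFragment {k} l 1≤t k≤out (((g , j) , Ag) , _) 2≤a ω≡k with refl ← inL _ Ag = record
    { t≡1      = t≡1
    ; 1≤s      = ≤-pred (subst (2 ≤_) size 2≤a)
    ; k≡1+s    = trans (≤-antisym k≤a a≤k) size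
    ; closed   = closed
    ; complete = complete
    }
    where
    a = count A
    k≤a : k ≤ a
    k≤a = fragment-size l k≤out A 2≤a ω≡k
    at≤a : a * t ≤ a
    at≤a = ≤-trans ∣A∣*t≤∣ω⁺∣ (≤-trans (≤-reflexive ω≡k) k≤a)
    t≤1 : t ≤ 1
    t≤1 = *-cancelˡ-≤ a {{>-nonZero (≤-trans (s≤s z≤n) 2≤a)}} (subst (a * t ≤_) (sym (*-identityʳ a)) at≤a)
    t≡1 : t ≡ 1
    t≡1 = ≤-antisym t≤1 1≤t
    a≤k : a ≤ k
    a≤k = subst₂ _≤_ (trans (cong (a *_) t≡1) (*-identityʳ a)) ω≡k ∣A∣*t≤∣ω⁺∣
    closed : LayerClosed D i A
    closed = ∣ω⁺∣≤∣A∣*t⇒closed (≤-trans (≤-reflexive ω≡k)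
      (≤-trans k≤a (≤-reflexive (sym (trans (cong (a *_) t≡1) (*-identityʳ a))))))
    a≤1+s : a ≤ suc s
    a≤1+s = ≤-trans a≤k (≤-trans (k≤out (g , i))
      (≤-reflexive (trans (outdeg≡ g) (trans (cong (s +_) t≡1) (+-comm s 1)))))
    -- From above, `a ≤ k` and `k` is at most the out-degree `s + 1`. From below, a vertex of `A`
    -- keeps its `s` out-neighbours of the layer in `A` and is distinct from them.
    size : a ≡ suc s
    size = ≤-antisym a≤1+s (≤-trans (s≤s (closed⇒s≤internal closed (g , i) Ag)) (internal-< D A l (g , i) Ag))
    complete : ∀ u w → A u ≡ true → A w ≡ true → u ≢ w → D u w ≡ true
    complete u w Au Aw u≢w with D u w in uw
    ... | true  = refl
    -- A missing arc would leave room for `s + 2` vertices in `A`: the `s` out-neighbours of `u`,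
    -- `u` itself and `w`.
    ... | false = contradiction a≤1+s
      (<⇒≱ (≤-trans (s≤s (s≤s (closed⇒s≤internal closed u Au))) (internal-<² D A l Au Aw u≢w uw)))

  -- Serves the converse implication: each vertex of `A` contributes just its one arc to the other
  -- layer.
  closed⇒∣ω⁺∣≡∣A∣ : t ≡ 1 → LayerClosed D i A → ∣ω⁺∣ D A ≡ count A
  closed⇒∣ω⁺∣≡∣A∣ t≡1 cl = Σᴸ-cong row (allV n)
    where
    row : ∀ u → external D A u ≡ 𝟙 (A u)
    row (g , j) with A (g , j) in Ag
    ... | false = Σᴸ-zero (allV n)
    ... | true with refl ← inL _ Ag =
      trans (count-layers i (λ w → not (A w) ∧ D (g , i) w)) (cong₂ _+_ none one)
      where
      none : countᶠ (λ h → not (A (h , i)) ∧ D (g , i) (h , i)) ≡ 0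
      none = trans (Σᴸ-cong (λ h → cong 𝟙 (stays h)) (allFin n)) (Σᴸ-zero (allFin n))
        where
        stays : ∀ h → not (A (h , i)) ∧ D (g , i) (h , i) ≡ false
        stays h with D (g , i) (h , i) in gh
        ... | false = Bool.∧-zeroʳ (not (A (h , i)))
        ... | true rewrite cl g h Ag gh = refl
      one : countᶠ (λ h → not (A (h , not i)) ∧ D (g , i) (h , not i)) ≡ 1
      one = trans (Σᴸ-cong (λ h → cong (λ b → 𝟙 (not b ∧ D (g , i) (h , not i))) (off-layer inL h)) (allFin n))
        (trans (across g) t≡1)

-- Vertex sets of the form `H × {i}`.

member⁺ : ∀ {n} {S : Subset n} {x} → x ∈ S → member S x ≡ true
member⁺ {S = S} {x} x∈S with x ∈? S
... | yes _   = refl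
... | no  x∉S = contradiction x∈S x∉S

member⁻ : ∀ {n} (S : Subset n) {x} → member S x ≡ true → x ∈ S
member⁻ S {x} p with x ∈? S
... | yes x∈S = x∈S

onLayer : ∀ {n} → Bool → V n → Bool
onLayer i v = ⌊ proj₂ v Bool.≟ i ⌋

onLayer⁻ : ∀ {n} i (v : V n) → onLayer i v ≡ true → proj₂ v ≡ i
onLayer⁻ i v p with proj₂ v Bool.≟ i
... | yes q = q

onLayer-not⁻ : ∀ {n} i (v : V n) → onLayer i v ≡ false → proj₂ v ≡ not i
onLayer-not⁻ i v p with proj₂ v Bool.≟ i
... | no q = Bool.¬-not q

onLayer-self : ∀ {n} i (g : Fin n) → onLayer i (g , i) ≡ true
onLayer-self false g = refl
onLayer-self true  g = refl

onLayer-other : ∀ {n} i (g : Fin n) → onLayer i (g , not i) ≡ false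
onLayer-other false g = refl
onLayer-other true  g = refl

inLayerSet : ∀ {n} → Subset n → Bool → VSet n
inLayerSet H i v = onLayer i v ∧ member H (proj₁ v)

module _ {n} (H : Subset n) (i : Bool) where

  inLayerSet⁺ : ∀ {g} → g ∈ H → inLayerSet H i (g , i) ≡ true
  inLayerSet⁺ {g} g∈H = cong₂ _∧_ (onLayer-self i g) (member⁺ g∈H)

  inLayerSet⁻ : ∀ {g} → inLayerSet H i (g , i) ≡ true → g ∈ H
  inLayerSet⁻ p = member⁻ H (proj₂ (∧-true⁻ p))

  inLayerSet-InLayer : InLayer i (inLayerSet H i)
  inLayerSet-InLayer v p = onLayer⁻ i v (proj₁ (∧-true⁻ p))

  count-inLayerSet : count (inLayerSet H i) ≡ ∣ H ∣
  count-inLayerSet = begin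
    count (inLayerSet H i)          ≡⟨ count-layers i (inLayerSet H i) ⟩
    countᶠ (λ g → onLayer i (g , i) ∧ member H g) + countᶠ (λ g → onLayer i (g , not i) ∧ member H g)
      ≡⟨ cong₂ _+_ (Σᴸ-cong (λ g → cong (λ b → 𝟙 (b ∧ member H g)) (onLayer-self i g)) (allFin n))
                   (Σᴸ-cong (λ g → cong (λ b → 𝟙 (b ∧ member H g)) (onLayer-other i g)) (allFin n)) ⟩
    countᶠ (member H) + Σᴸ (allFin n) (λ _ → 0)
      ≡⟨ cong₂ _+_ (countᶠ-member H) (Σᴸ-zero (allFin n)) ⟩
    ∣ H ∣ + 0                       ≡⟨ +-identityʳ _ ⟩
    ∣ H ∣                           ∎
    where open ≡-Reasoning

-- Quotients in the group and subgroup criteria.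

module _ {n} (G : FinGroup n) where

  private
    group : Group _ _
    group = record { isGroup = isGroup G }

  open Group group using (_∙_; ε; _⁻¹; _//_; assoc; identityˡ; inverseʳ)
  open GroupProperties group
    using (//-rightDividesˡ; //-rightDividesʳ; ⁻¹-anti-homo-∙; ⁻¹-anti-homo-//; ⁻¹-involutive; ε⁻¹≈ε)

  //-x⁻¹y : ∀ x y → y // (x ⁻¹ ∙ y) ≡ x
  //-x⁻¹y x y = begin
    y // (x ⁻¹ ∙ y)        ≡⟨ ⁻¹-anti-homo-// (x ⁻¹ ∙ y) y ⟨
    ((x ⁻¹ ∙ y) // y) ⁻¹   ≡⟨ cong _⁻¹ (//-rightDividesʳ y (x ⁻¹)) ⟩
    x ⁻¹ ⁻¹                ≡⟨ ⁻¹-involutive x ⟩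
    x                      ∎
    where open ≡-Reasoning

  [y//x]⁻¹y : ∀ x y → (y // x) ⁻¹ ∙ y ≡ x
  [y//x]⁻¹y x y = trans (cong (_∙ y) (⁻¹-anti-homo-// y x)) (//-rightDividesˡ y x)

  countᶠ-//ˡ : ∀ P g → countᶠ (λ h → member P (h // g)) ≡ ∣ P ∣
  countᶠ-//ˡ P g = trans
    (countᶠ-permute (member P) (_// g) (_∙ g) (//-rightDividesʳ g) (//-rightDividesˡ g))
    (countᶠ-member P)

  -- With `g` as numerator, `h ↦ g // h` is a bijection whose inverse is `x ↦ x ⁻¹ ∙ g`.
  countᶠ-//ʳ : ∀ P g → countᶠ (λ h → member P (g // h)) ≡ ∣ P ∣
  countᶠ-//ʳ P g = trans
    (countᶠ-permute (member P) (g //_) (λ x → x ⁻¹ ∙ g) (λ x → //-x⁻¹y x g) (λ h → [y//x]⁻¹y h g))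
    (countᶠ-member P)

  module _ {H : Subset n} (B : Fin n → Set) {b} (b∈B : B b)
           (quotient : ∀ g h → B g → B h → (h // g) ∈ H) where

    -- The hypotheses make `H b` equal to `B`. Products and inverses then appear as quotients in
    -- `B`: `x y` is `x y b` over `b`, and `x ⁻¹` is `b` over `x b`.
    translates⇒subgroup : (∀ x g → x ∈ H → B g → B (x ∙ g)) → IsSubgroup G H
    translates⇒subgroup move =
      subst (_∈ H) (inverseʳ b) (quotient b b b∈B b∈B) ,
      (λ x y x∈H y∈H → subst (_∈ H)
        (trans (cong (_// b) (sym (assoc x y b))) (//-rightDividesʳ b (x ∙ y)))
        (quotient b (x ∙ (y ∙ b)) b∈B (move x _ x∈H (move y b y∈H b∈B)))) ,
      (λ x x∈H → subst (_∈ H)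
        (trans (sym (⁻¹-anti-homo-// (x ∙ b) b)) (cong _⁻¹ (//-rightDividesʳ b x)))
        (quotient (x ∙ b) b (move x b x∈H b∈B) b∈B))

    -- The variant for in-cuts. Now `x y` is `b` over `y ⁻¹ x ⁻¹ b`, and `x ⁻¹` is `x ⁻¹ b` over
    -- `b`.
    inverse-translates⇒subgroup : (∀ x g → x ∈ H → B g → B (x ⁻¹ ∙ g)) → IsSubgroup G H
    inverse-translates⇒subgroup move =
      subst (_∈ H) (inverseʳ b) (quotient b b b∈B b∈B) ,
      (λ x y x∈H y∈H → subst (_∈ H)
        (trans (cong (b //_) (trans (sym (assoc (y ⁻¹) (x ⁻¹) b)) (cong (_∙ b) (sym (⁻¹-anti-homo-∙ x y)))))
               (//-x⁻¹y (x ∙ y) b))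
        (quotient (y ⁻¹ ∙ (x ⁻¹ ∙ b)) b (move y _ y∈H (move x b x∈H b∈B)) b∈B)) ,
      (λ x x∈H → subst (_∈ H) (//-rightDividesʳ b (x ⁻¹))
        (quotient b (x ⁻¹ ∙ b) b∈B (move x b x∈H b∈B)))

  ∈-adjoin-e⁻ : ∀ (S : Subset n) {x} → x ∈ S ∪ ⁅ ε ⁆ → x ∈ S ⊎ x ≡ ε
  ∈-adjoin-e⁻ S x∈H with x∈p∪q⁻ S ⁅ ε ⁆ x∈H
  ... | inj₁ x∈S = inj₁ x∈S
  ... | inj₂ x∈e = inj₂ (x∈⁅y⁆⇒x≡y ε x∈e)

  -- Mixed Cayley digraphs, with connection sets indexed by the layer that their arcs leave.

  module Mixed (S T : Bool → Subset n) (e∉S : ∀ i → ε ∉ S i) where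

    D : Digraph n
    D = MD G (S false) (S true) (T false) (T true)

    H : Bool → Subset n
    H i = S i ∪ ⁅ ε ⁆

    arc-within : ∀ i g h → D (g , i) (h , i) ≡ member (S i) (h // g)
    arc-within false g h = Bool.∨-identityʳ _
    arc-within true  g h = Bool.∨-identityʳ _

    D-loopless : Loopless D
    D-loopless = loopless arc-free
      where
      arc-free : ∀ u → D u u ≡ false
      arc-free (g , i) with member (S i) (g // g) in eq
      ... | true  = contradiction (subst (_∈ S i) (inverseʳ g) (member⁻ (S i) eq)) (e∉S i)
      ... | false = trans (arc-within i g g) eq

    regular⁺ : ∀ i → LayerRegular D i ∣ S i ∣ ∣ T i ∣
    regular⁺ i = record
      { within = λ g → trans (Σᴸ-cong (λ h → cong 𝟙 (arc-within i g h)) (allFin n)) (countᶠ-//ˡ (S i) g)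
      ; across = across i
      }
      where
      across : ∀ i g → countᶠ (λ h → D (g , i) (h , not i)) ≡ ∣ T i ∣
      -- For arcs from layer 1 to layer 0 the tail is the numerator of the quotient, so the two
      -- layers need different counts.
      across false g = countᶠ-//ˡ (T false) g
      across true  g = countᶠ-//ʳ (T true) g

    -- In-degrees of `D` are out-degrees of `flip D`. Arcs entering layer `i` from the other layer
    -- come from `T (not i)`.
    regular⁻ : ∀ i → LayerRegular (flip D) i ∣ S i ∣ ∣ T (not i) ∣
    regular⁻ i = record
      { within = λ g → trans (Σᴸ-cong (λ h → cong 𝟙 (arc-within i h g)) (allFin n)) (countᶠ-//ʳ (S i) g)
      ; across = across i
      }
      where
      across : ∀ i g → countᶠ (λ h → D (h , not i) (g , i)) ≡ ∣ T (not i) ∣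
      across false g = countᶠ-//ˡ (T true) g
      across true  g = countᶠ-//ʳ (T false) g

    -- A walk to the other layer has to leave layer `i`, and only `T i` provides such arcs.
    stronglyConnected⇒T-nonempty : StronglyConnected D → ∀ i → 1 ≤ ∣ T i ∣
    stronglyConnected⇒T-nonempty sc i
      with (g , j) , (h , l) , g∈ , h∉ , gh ←
        Reach-leaves (onLayer i) (onLayer-self i ε) (onLayer-other i ε) (sc (ε , i) (ε , not i))
      with refl ← onLayer⁻ i (g , j) g∈ | refl ← onLayer-not⁻ i (h , l) h∉ =
      subst (1 ≤_) (LayerRegular.across (regular⁺ i) g) (countᶠ-positive _ h gh)

    module _ {i : Bool} {A : VSet n} (A≢∅ : ∃ λ v → A v ≡ true) (inL : InLayer i A) where

      private
        B : Fin n → Set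
        B g = A (g , i) ≡ true

        witness : ∃ B
        witness = base A≢∅
          where
          base : (∃ λ v → A v ≡ true) → ∃ B
          base ((g , j) , Ag) with refl ← inL _ Ag = g , Ag

        complete⇒quotient : (∀ u w → A u ≡ true → A w ≡ true → u ≢ w → D u w ≡ true) →
                            ∀ g h → B g → B h → (h // g) ∈ H i
        complete⇒quotient complete g h Ag Ah with g Fin.≟ h
        ... | yes refl = x∈p∪q⁺ (inj₂ (subst (_∈ ⁅ ε ⁆) (sym (inverseʳ g)) (x∈⁅x⁆ ε)))
        ... | no  g≢h  = x∈p∪q⁺ (inj₁ (member⁻ (S i) (trans (sym (arc-within i g h))
                           (complete _ _ Ag Ah (g≢h ∘ cong proj₁)))))

      fragment⁺⇒subgroup : ∀ {s t k} → LayerFragment D i s t k A → IsSubgroup G (H i)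
      fragment⁺⇒subgroup F = translates⇒subgroup B (proj₂ witness) (complete⇒quotient complete) move
        where
        open LayerFragment F
        move : ∀ x g → x ∈ H i → B g → B (x ∙ g)
        move x g x∈H Ag with ∈-adjoin-e⁻ (S i) x∈H
        ... | inj₁ x∈S  = closed g (x ∙ g) Ag (trans (arc-within i g (x ∙ g))
                            (member⁺ (subst (_∈ S i) (sym (//-rightDividesʳ g x)) x∈S)))
        ... | inj₂ refl = subst B (sym (identityˡ g)) Ag

      -- In `flip D` the neighbours of `g` in its layer are the `x ⁻¹ ∙ g` with `x` in `S i`, which
      -- calls for the criterion with inverses; completeness is used with the endpoints exchanged.
      fragment⁻⇒subgroup : ∀ {s t k} → LayerFragment (flip D) i s t k A → IsSubgroup G (H i)
      fragment⁻⇒subgroup F = inverse-translates⇒subgroup B (proj₂ witness)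
        (complete⇒quotient λ u w Au Aw u≢w → complete w u Aw Au (≢-sym u≢w)) move
        where
        open LayerFragment F
        move : ∀ x g → x ∈ H i → B g → B (x ⁻¹ ∙ g)
        move x g x∈H Ag with ∈-adjoin-e⁻ (S i) x∈H
        ... | inj₁ x∈S  = closed g (x ⁻¹ ∙ g) Ag (trans (arc-within i (x ⁻¹ ∙ g) g)
                            (member⁺ (subst (_∈ S i) (sym (//-x⁻¹y x g)) x∈S)))
        ... | inj₂ refl = subst B (sym (trans (cong (_∙ g) ε⁻¹≈ε) (identityˡ g))) Ag

    module _ {i : Bool} (sub : IsSubgroup G (H i)) where

      private
        mul-closed = proj₁ (proj₂ sub)
        inv-closed = proj₂ (proj₂ sub)
        A = inLayerSet (H i) i

      subgroup⇒closed⁺ : LayerClosed D i A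
      subgroup⇒closed⁺ g h g∈A gh = inLayerSet⁺ (H i) i (subst (_∈ H i) (//-rightDividesˡ g h)
        (mul-closed (h // g) g
          (x∈p∪q⁺ (inj₁ (member⁻ (S i) (trans (sym (arc-within i g h)) gh))))
          (inLayerSet⁻ (H i) i g∈A)))

      -- Following an arc backwards multiplies by an inverse, so closure of `H i` under inverses
      -- enters.
      subgroup⇒closed⁻ : LayerClosed (flip D) i A
      subgroup⇒closed⁻ g h g∈A hg = inLayerSet⁺ (H i) i (subst (_∈ H i) ([y//x]⁻¹y h g)
        (mul-closed ((g // h) ⁻¹) g
          (inv-closed _ (x∈p∪q⁺ (inj₁ (member⁻ (S i) (trans (sym (arc-within i h g)) hg)))))
          (inLayerSet⁻ (H i) i g∈A)))

    -- The two alternatives of the theorem are its values at `false` and `true`.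
    Condition : Bool → Set
    Condition i = (∣ T false ∣ ≡ 1 ⊎ ∣ T true ∣ ≡ 1) × 1 ≤ ∣ S i ∣ × ∣ S i ∣ ≤ ∣ S (not i) ∣ ×
                  IsSubgroup G (H i)

    -- The diagonals of `D` and `flip D` agree. The proof is rewrapped because the record `Loopless`
    -- keeps track of which digraph is meant.
    D⁻-loopless : Loopless (flip D)
    D⁻-loopless = loopless (Loopless.no-loop D-loopless)

    some-T≡1⁺ : ∀ i → ∣ T i ∣ ≡ 1 → ∣ T false ∣ ≡ 1 ⊎ ∣ T true ∣ ≡ 1
    some-T≡1⁺ false = inj₁
    some-T≡1⁺ true  = inj₂

    some-T≡1⁻ : ∀ i → ∣ T false ∣ ≡ 1 ⊎ ∣ T true ∣ ≡ 1 → ∣ T i ∣ ≡ 1 ⊎ ∣ T (not i) ∣ ≡ 1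
    some-T≡1⁻ false = id
    some-T≡1⁻ true  = swap

    indeg≡ : ∀ i g → indeg D (g , i) ≡ ∣ S i ∣ + ∣ T (not i) ∣
    indeg≡ i = LayerRegular.outdeg≡ (regular⁻ i)

    outdeg≡ : ∀ i g → outdeg D (g , i) ≡ ∣ S i ∣ + ∣ T i ∣
    outdeg≡ i = LayerRegular.outdeg≡ (regular⁺ i)

    -- The two implications, with `k` both the arc-connectivity and the minimum degree.

    module _ {k} (conn : IsArcConn D k) (minDeg : IsMinDeg D k) where

      private
        k≤in : ∀ v → k ≤ indeg D v
        k≤in v = proj₁ (proj₂ minDeg v)
        k≤out : ∀ v → k ≤ outdeg D v
        k≤out v = proj₂ (proj₂ minDeg v)

      -- The comparison of `S i` with `S (not i)` comes from a vertex of the other layer. Its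
      -- in-degree (for an out-cut) or out-degree (for an in-cut) involves the same one-element
      -- connection set, so it is `∣ S (not i) ∣ + 1`, and it is at least `k`.
      fragment⇒condition : (∀ i → 1 ≤ ∣ T i ∣) → ∀ {i A} → ArcFragment D k A → 2 ≤ ∣ A ∣ᵥ →
                           InLayer i A → Condition i
      fragment⇒condition 1≤T {i} {A} (proper , inj₁ ω⁺≡k) 2≤a inL =
        some-T≡1⁺ i t≡1 , 1≤s , ≤-pred s<s′ , fragment⁺⇒subgroup (proj₁ proper) inL F
        where
        F = layerFragment (regular⁺ i) inL D-loopless (1≤T i) k≤out proper 2≤a ω⁺≡k
        open LayerFragment F
        open ≤-Reasoning
        s<s′ : suc ∣ S i ∣ ≤ suc ∣ S (not i) ∣
        s<s′ = begin
          suc ∣ S i ∣                            ≡⟨ k≡1+s ⟨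
          k                                      ≤⟨ k≤in (ε , not i) ⟩
          indeg D (ε , not i)                    ≡⟨ indeg≡ (not i) ε ⟩
          ∣ S (not i) ∣ + ∣ T (not (not i)) ∣    ≡⟨ cong (λ j → ∣ S (not i) ∣ + ∣ T j ∣) (Bool.not-involutive i) ⟩
          ∣ S (not i) ∣ + ∣ T i ∣                ≡⟨ cong (∣ S (not i) ∣ +_) t≡1 ⟩
          ∣ S (not i) ∣ + 1                      ≡⟨ +-comm _ 1 ⟩
          suc ∣ S (not i) ∣                      ∎
      fragment⇒condition 1≤T {i} {A} (proper , inj₂ ω⁻≡k) 2≤a inL =
        some-T≡1⁺ (not i) t≡1 , 1≤s , ≤-pred s<s′ , fragment⁻⇒subgroup (proj₁ proper) inL F
        where
        F = layerFragment (regular⁻ i) inL D⁻-loopless (1≤T (not i)) k≤in proper 2≤a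
              (trans (∣ω⁺∣-flip D A) ω⁻≡k)
        open LayerFragment F
        open ≤-Reasoning
        s<s′ : suc ∣ S i ∣ ≤ suc ∣ S (not i) ∣
        s<s′ = begin
          suc ∣ S i ∣                            ≡⟨ k≡1+s ⟨
          k                                      ≤⟨ k≤out (ε , not i) ⟩
          outdeg D (ε , not i)                   ≡⟨ outdeg≡ (not i) ε ⟩
          ∣ S (not i) ∣ + ∣ T (not i) ∣          ≡⟨ cong (∣ S (not i) ∣ +_) t≡1 ⟩
          ∣ S (not i) ∣ + 1                      ≡⟨ +-comm _ 1 ⟩
          suc ∣ S (not i) ∣                      ∎

      -- `k` is attained as a degree, and every degree is the size of some `S j` plus that of some
      -- `T j′`.
      min≤k : ∀ {s t} → (∀ j → s ≤ ∣ S j ∣) → (∀ j → t ≤ ∣ T j ∣) → s + t ≤ k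
      min≤k {s} {t} s≤S t≤T = bound (proj₁ minDeg)
        where
        bound : (Σ (V n) λ v → indeg D v ≡ k ⊎ outdeg D v ≡ k) → s + t ≤ k
        bound ((g , j) , inj₁ refl) = ≤-trans (+-mono-≤ (s≤S j) (t≤T (not j))) (≤-reflexive (sym (indeg≡ j g)))
        bound ((g , j) , inj₂ refl) = ≤-trans (+-mono-≤ (s≤S j) (t≤T j)) (≤-reflexive (sym (outdeg≡ j g)))

      condition⇒InG : ∀ i → Condition i → InG D
      condition⇒InG i (T≡1 , 1≤s , s≤s′ , sub) =
        sc , k , conn , A , ((proper , ω≡k) , 2≤a , minimal) , in-some-layer i inL
        where
        A = inLayerSet (H i) i
        inL : InLayer i A
        inL = inLayerSet-InLayer (H i) i
        proper : ProperNonempty A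
        proper = ((ε , i) , inLayerSet⁺ (H i) i (proj₁ sub)) , ((ε , not i) , off-layer inL ε)
        ∣A∣≡1+s : count A ≡ suc ∣ S i ∣
        ∣A∣≡1+s = trans (count-inLayerSet (H i) i) (∣p∪⁅x⁆∣≡1+∣p∣ (e∉S i))
        s≤S : ∀ i → ∣ S i ∣ ≤ ∣ S (not i) ∣ → ∀ j → ∣ S i ∣ ≤ ∣ S j ∣
        s≤S false h false = ≤-refl
        s≤S false h true  = h
        s≤S true  h false = h
        s≤S true  h true  = ≤-refl
        -- The degree bound is used twice. With `0` for the sizes of the `T j` it gives `1 ≤ k`,
        -- hence strong connectivity, hence nonempty `T j`; with `1` it then gives
        -- `1 + ∣ S i ∣ ≤ k`.
        1≤k : 1 ≤ k
        1≤k = ≤-trans 1≤s (subst (_≤ k) (+-identityʳ _) (min≤k (s≤S i s≤s′) (λ _ → z≤n)))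
        sc : StronglyConnected D
        sc = λ-positive⇒stronglyConnected 1≤k conn
        1+s≤k : suc ∣ S i ∣ ≤ k
        1+s≤k = subst (_≤ k) (+-comm _ 1) (min≤k (s≤S i s≤s′) (stronglyConnected⇒T-nonempty sc))
        -- `d` is the out-degree or the in-degree of `(ε , i)`, according to whether `T i` or
        -- `T (not i)` has one element.
        k≡∣A∣ : ∀ {d t} → k ≤ d → d ≡ ∣ S i ∣ + t → t ≡ 1 → count A ≡ k
        k≡∣A∣ k≤d refl refl = trans ∣A∣≡1+s (≤-antisym 1+s≤k (≤-trans k≤d (≤-reflexive (+-comm _ 1))))
        ∣A∣≡k : count A ≡ k
        ∣A∣≡k = [ k≡∣A∣ (k≤out (ε , i)) (outdeg≡ i ε) , k≡∣A∣ (k≤in (ε , i)) (indeg≡ i ε) ]′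
                  (some-T≡1⁻ i T≡1)
        ω≡k : ∣ω⁺∣ D A ≡ k ⊎ ∣ω⁻∣ D A ≡ k
        ω≡k with some-T≡1⁻ i T≡1
        ... | inj₁ t≡1 = inj₁ (trans
          (closed⇒∣ω⁺∣≡∣A∣ (regular⁺ i) inL t≡1 (subgroup⇒closed⁺ sub)) ∣A∣≡k)
        ... | inj₂ t≡1 = inj₂ (trans (sym (∣ω⁺∣-flip D A)) (trans
          (closed⇒∣ω⁺∣≡∣A∣ (regular⁻ i) inL t≡1 (subgroup⇒closed⁻ sub)) ∣A∣≡k))
        2≤a : 2 ≤ count A
        2≤a = subst (2 ≤_) (sym ∣A∣≡1+s) (s≤s 1≤s)
        -- Any competitor has at least `k` vertices by `fragment-size`, and `A` has exactly `k`.
        minimal : ∀ B → ArcFragment D k B → 2 ≤ ∣ B ∣ᵥ → count A ≤ ∣ B ∣ᵥ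
        minimal B (_ , inj₁ ω⁺≡k) 2≤b = subst (_≤ count B) (sym ∣A∣≡k)
          (fragment-size D-loopless k≤out B 2≤b ω⁺≡k)
        minimal B (_ , inj₂ ω⁻≡k) 2≤b = subst (_≤ count B) (sym ∣A∣≡k)
          (fragment-size D⁻-loopless k≤in B 2≤b (trans (∣ω⁺∣-flip D B) ω⁻≡k))
        in-some-layer : ∀ i → InLayer i A → InLayer false A ⊎ InLayer true A
        in-some-layer false = inj₁
        in-some-layer true  = inj₂

      InG⇒condition : InG D → Condition false ⊎ Condition true
      InG⇒condition (sc , l , conn′ , A , (fragment , 2≤a , _) , inL)
        with refl ← IsArcConn-unique conn conn′ =
        map₊ (fragment⇒condition 1≤T fragment 2≤a) (fragment⇒condition 1≤T fragment 2≤a) inL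
        where
        1≤T = stronglyConnected⇒T-nonempty sc

theorem4p8 : ∀ {n} (G : FinGroup n) (S₀ S₁ T₀ T₁ : Subset n) →
    e G ∉ S₀ → e G ∉ S₁ →
    MaxLambda (MD G S₀ S₁ T₀ T₁) →
    ¬ SuperLambda (MD G S₀ S₁ T₀ T₁) →
    ¬ IsDirectedCycle (MD G S₀ S₁ T₀ T₁) →
    ¬ IsCycle (MD G S₀ S₁ T₀ T₁) →
    ¬ InF G S₀ S₁ T₀ T₁ →
    InG (MD G S₀ S₁ T₀ T₁) ⇔
    (((∣ T₀ ∣ ≡ 1 ⊎ ∣ T₁ ∣ ≡ 1) × 1 ≤ ∣ S₀ ∣ × ∣ S₀ ∣ ≤ ∣ S₁ ∣ × IsSubgroup G (S₀ ∪ ⁅ e G ⁆))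
    ⊎
    ((∣ T₀ ∣ ≡ 1 ⊎ ∣ T₁ ∣ ≡ 1) × 1 ≤ ∣ S₁ ∣ × ∣ S₁ ∣ ≤ ∣ S₀ ∣ × IsSubgroup G (S₁ ∪ ⁅ e G ⁆)))
theorem4p8 {n} G S₀ S₁ T₀ T₁ e∉S₀ e∉S₁ (k , conn , minDeg) _ _ _ _ =
  mk⇔ (InG⇒condition conn minDeg)
      [ condition⇒InG conn minDeg false , condition⇒InG conn minDeg true ]′
  where
  S T : Bool → Subset n
  S i = if i then S₁ else S₀
  T i = if i then T₁ else T₀
  e∉S : ∀ i → e G ∉ S i
  e∉S false = e∉S₀
  e∉S true  = e∉S₁
  open Mixed G S T e∉S
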